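{- $\Sigma(\mathrm{NLIM}_{\mathbb N})\not\leq_{\mathrm W}\mathrm{WKL}$.
   Context: A represented space is a set $X$ with a partial surjective map $\delta_X:\subseteq\mathbb N^{\mathbb N}\to X$. A problem is a partial multi-valued function $f:\subseteq X\rightrightarrows Y$ between represented spaces that has a realizer; a realizer of $f$ is a function $F:\subseteq\mathbb N^{\mathbb N}\to\mathbb N^{\mathbb N}$ with $\delta_YF(p)\in f\delta_X(p)$ for all $p\in\mathrm{dom}(f\delta_X)$. For $p,q\in\mathbb N^{\mathbb N}$, $\langle p,q\rangle(2n)=p(n)$, $\langle p,q\rangle(2n+1)=q(n)$. For problems $f,g$: $f\leq_{\mathrm W}g$ if there are computable $H,K:\subseteq\mathbb N^{\mathbb N}\to\mathbb N^{\mathbb N}$ such that $H\langle\mathrm{id},GK\rangle$ is a realizer of $f$ whenever $G$ is a realizer of $g$. For a represented space $Y$, the completion $\overline Y:=Y\cup\{\bot\}$ ($\bot\notin Y$) is represented by the total map $\delta_{\overline Y}$ with $\delta_{\overline Y}(p)=\delta_Y(p-1)$ if $p-1\in\mathrm{dom}(\delta_Y)$ and $\delta_{\overline Y}(p)=\bot$ otherwise, where $p-1\in\mathbb N^{\mathbb N}\cup\mathbb N^*$ is the concatenation of $p(0)-1,p(1)-1,\dots$ and $0-1$ is the empty word. $\mathbb N^{\mathbb N}$ and $2^{\mathbb N}$ are represented by (restrictions of) the identity, $\mathbb N$ by $p\mapsto p(0)$, and $X^{\mathbb N}$ by $\langle p_0,p_1,\dots\rangle\mapsto(\delta_X(p_n))_n$,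 where $\langle p_0,p_1,\dots\rangle\langle n,k\rangle:=p_n(k)$ and $\langle n,k\rangle:=\frac12(n+k)(n+k+1)+k$ for $n,k\in\mathbb N$. Stashing: for $f:\subseteq X\rightrightarrows Y$, $\Sigma f:\subseteq X^{\mathbb N}\rightrightarrows\overline Y^{\mathbb N}$ has domain $\mathrm{dom}(f)^{\mathbb N}$ and $\Sigma f((x_n)_n)=\{(y_n)_n\in\overline Y^{\mathbb N}:(\exists n)\ y_n\in f(x_n)\}$. The limit avoidance problem is $\mathrm{NLIM}_{\mathbb N}:\subseteq\mathbb N^{\mathbb N}\rightrightarrows\mathbb N$, $p\mapsto\{k\in\mathbb N:\lim_{n\to\infty}p(n)\neq k\}$, with domain the set of all $p$ for which $(p(n))_n$ converges (in the discrete space $\mathbb N$). $\mathrm{WKL}:\subseteq\mathrm{Tr}\rightrightarrows2^{\mathbb N}$, $T\mapsto[T]$, with domain the set of infinite trees, where $\mathrm{Tr}$ is the set of binary trees $T\subseteq\{0,1\}^*$ (represented by characteristic functions) and $[T]$ is the set of infinite paths of $T$. -}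

module Defs where

open import Axiom.ExcludedMiddle using (ExcludedMiddle)
open import Data.Bool.Base using (Bool; true; false; if_then_else_)
open import Data.Empty using (⊥-elim)
open import Data.Fin.Base using (Fin; zero; suc; toℕ)
open import Data.Fin.Patterns using (0F; 1F)
open import Data.Fin.Properties using (toℕ-injective)
open import Data.List.Base
  using (List; []; _∷_; [_]; _++_; _∷ʳ_; length; map; concatMap; applyUpTo)
open import Data.List.Properties
  using (∷-injective; length-applyUpTo; applyUpTo-∷ʳ; ++-assoc)
open import Data.List.Membership.Propositional using (_∈_; _∉_)
open import Data.List.Membership.Propositional.Properties
  using (∈-map⁺; ∈-++⁺ˡ; ∈-++⁺ʳ)
open import Data.List.Relation.Unary.Any using (here; there)
open import Data.Maybe.Base using (Maybe; just; nothing)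
import Data.Maybe.Relation.Binary.Pointwise as Maybeᴾ
open import Data.Nat.Base
open import Data.Nat.Binary.Base as ℕᵇ using (ℕᵇ; 2[1+_]; 1+[2_])
open import Data.Nat.Binary.Properties using (fromℕ-toℕ)
open import Data.Nat.DivMod using (_/_; _%_; m*n/n≡m; +-distrib-/-∣ʳ)
open import Data.Nat.Divisibility using (n∣m*n)
open import Data.Nat.Properties
open import Data.Nat.Tactic.RingSolver using (solve-∀)
open import Data.Product using (Σ-syntax; ∃; ∃-syntax; _×_; _,_; proj₁; proj₂)
open import Data.Unit.Base using (⊤)
open import Data.Vec.Base as Vec using (Vec; []; _∷_)
open import Function.Base using (_∘_)
open import Function.Bundles using (mk⇔)
open import Level using (0ℓ)
open import Relation.Binary.Bundles using (Setoid)
open import Relation.Binary.Core using (REL)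
open import Relation.Binary.Definitions using (_Respects_; _Respectsˡ_; _Respectsʳ_)
open import Relation.Binary.PropositionalEquality as ≡
  using (_≡_; _≗_; _→-setoid_; refl; sym; trans; cong; cong₂; subst; module ≡-Reasoning)
open import Relation.Nullary using (¬_; Dec; yes; no; does)
open import Relation.Nullary.Decidable using (does-⇔)
open import Relation.Unary using (Pred)

Baire : Set
Baire = ℕ → ℕ

BaireSetoid : Setoid 0ℓ 0ℓ
BaireSetoid = ℕ →-setoid ℕ

-- Partial functions are single-valued graphs, so that, as in set theory,
-- a partial function need not come with a means of evaluating it.

record _⇀_ (A B : Setoid 0ℓ 0ℓ) : Set₁ where
  private
    module A = Setoid A
    module B = Setoid B
  field
    graph       : REL A.Carrier B.Carrier 0ℓ
    graph-respˡ : graph Respectsˡ A._≈_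
    graph-respʳ : graph Respectsʳ B._≈_
    functional  : ∀ {a b b′} → graph a b → graph a b′ → b B.≈ b′

open _⇀_ public

Baire⇀Baire : Set₁
Baire⇀Baire = BaireSetoid ⇀ BaireSetoid

⟨_,_⟩ : Baire → Baire → Baire
⟨ p , q ⟩ n = if n % 2 ≡ᵇ 0 then p (n / 2) else q (n / 2)

⟨,⟩-cong : ∀ {p p′ q q′} → p ≗ p′ → q ≗ q′ → ⟨ p , q ⟩ ≗ ⟨ p′ , q′ ⟩
⟨,⟩-cong e e′ n with n % 2 ≡ᵇ 0
... | true  = e (n / 2)
... | false = e′ (n / 2)

idᵖ : Baire⇀Baire
idᵖ .graph p q = p ≗ q
idᵖ .graph-respˡ p≗p′ p≗q n = trans (sym (p≗p′ n)) (p≗q n)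
idᵖ .graph-respʳ q≗q′ p≗q n = trans (p≗q n) (q≗q′ n)
idᵖ .functional p≗q p≗q′ n = trans (sym (p≗q n)) (p≗q′ n)

infixr 9 _∘ᵖ_

_∘ᵖ_ : Baire⇀Baire → Baire⇀Baire → Baire⇀Baire
(F ∘ᵖ G) .graph p r = ∃[ q ] graph G p q × graph F q r
(F ∘ᵖ G) .graph-respˡ e (q , g , f) = q , graph-respˡ G e g , f
(F ∘ᵖ G) .graph-respʳ e (q , g , f) = q , g , graph-respʳ F e f
(F ∘ᵖ G) .functional (q , g , f) (q′ , g′ , f′) =
  functional F (graph-respˡ F (functional G g g′) f) f′

⟨_,_⟩ᵖ : Baire⇀Baire → Baire⇀Baire → Baire⇀Baire
⟨ F , G ⟩ᵖ .graph p s = ∃[ q ] ∃[ r ] graph F p q × graph G p r × ⟨ q , r ⟩ ≗ s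
⟨ F , G ⟩ᵖ .graph-respˡ e (q , r , f , g , h) = q , r , graph-respˡ F e f , graph-respˡ G e g , h
⟨ F , G ⟩ᵖ .graph-respʳ e (q , r , f , g , h) = q , r , f , g , λ n → trans (h n) (e n)
⟨ F , G ⟩ᵖ .functional (q , r , f , g , h) (q′ , r′ , f′ , g′ , h′) n =
  trans (sym (h n))
    (trans (⟨,⟩-cong (functional F f f′) (functional G g g′) n) (h′ n))

-- Partial recursive functions relative to an oracle.

data Code : ℕ → Set where
  zero   : Code 0
  succ   : Code 1
  oracle : Code 1
  proj   : ∀ {n} → Fin n → Code n
  comp   : ∀ {m n} → Code m → Vec (Code n) m → Code n
  prec   : ∀ {n} → Code n → Code (2 + n) → Code (1 + n)
  min    : ∀ {n} → Code (1 + n) → Code n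

PrecGraph : Pred ℕ 0ℓ → (ℕ → ℕ → Pred ℕ 0ℓ) → ℕ → Pred ℕ 0ℓ
PrecGraph base step zero    y = base y
PrecGraph base step (suc k) y = ∃[ r ] PrecGraph base step k r × step k r y

mutual
  -- ⟦ c ⟧ p xs y : with oracle p and arguments xs, the computation of c
  -- terminates with value y.
  ⟦_⟧ : ∀ {n} → Code n → Baire → Vec ℕ n → Pred ℕ 0ℓ
  ⟦ zero ⟧      p xs       y = 0 ≡ y
  ⟦ succ ⟧      p (x ∷ []) y = suc x ≡ y
  ⟦ oracle ⟧    p (x ∷ []) y = p x ≡ y
  ⟦ proj i ⟧    p xs       y = Vec.lookup xs i ≡ y
  ⟦ comp c ds ⟧ p xs       y = ∃[ zs ] ⟦ ds ⟧* p xs zs × ⟦ c ⟧ p zs y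
  ⟦ prec c d ⟧  p (k ∷ xs) y =
    PrecGraph (⟦ c ⟧ p xs) (λ j r → ⟦ d ⟧ p (j ∷ r ∷ xs)) k y
  ⟦ min c ⟧     p xs       y =
    ⟦ c ⟧ p (y ∷ xs) 0 × (∀ j → j < y → ∃[ z ] ⟦ c ⟧ p (j ∷ xs) (suc z))

  ⟦_⟧* : ∀ {m n} → Vec (Code n) m → Baire → Vec ℕ n → Pred (Vec ℕ m) 0ℓ
  ⟦ [] ⟧*     p xs []       = ⊤
  ⟦ d ∷ ds ⟧* p xs (z ∷ zs) = ⟦ d ⟧ p xs z × ⟦ ds ⟧* p xs zs

-- The machine computes F(p) for p in the domain of F; nothing is required
-- of it on other oracles.

Computable : Baire⇀Baire → Set
Computable F =
  ∃[ c ] (∀ {p q} → graph F p q → ∀ n → ⟦ c ⟧ p (n ∷ []) (q n))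

record RepresentedSpace : Set₁ where
  field
    setoid     : Setoid 0ℓ 0ℓ
    δ          : BaireSetoid ⇀ setoid
    surjective : ∀ x → ∃[ p ] graph δ p x

  open Setoid setoid public

-- The values of a multi-valued function are meaningful only on its domain.

record _⇉_ (X Y : RepresentedSpace) : Set₁ where
  private
    module X = RepresentedSpace X
    module Y = RepresentedSpace Y
  field
    dom         : Pred X.Carrier 0ℓ
    value       : X.Carrier → Pred Y.Carrier 0ℓ
    dom-resp    : dom Respects X._≈_
    value-respˡ : value Respectsˡ X._≈_
    value-respʳ : value Respectsʳ Y._≈_

open _⇉_ public

_Realizes_ : ∀ {X Y} → Baire⇀Baire → X ⇉ Y → Set
_Realizes_ {X} {Y} F f =
  ∀ p x → graph X.δ p x → dom f x →
  ∃[ q ] ∃[ y ] graph F p q × graph Y.δ q y × value f x y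
  where
    module X = RepresentedSpace X
    module Y = RepresentedSpace Y

record Problem : Set₁ where
  field
    {source target} : RepresentedSpace
    function        : source ⇉ target
    realizer        : Σ[ F ∈ Baire⇀Baire ] F Realizes function

open Problem public

infix 4 _≤W_

_≤W_ : Problem → Problem → Set₁
f ≤W g =
  Σ[ H ∈ Baire⇀Baire ] Σ[ K ∈ Baire⇀Baire ] Computable H × Computable K ×
  (∀ (G : Baire⇀Baire) → G Realizes function g →
     (H ∘ᵖ ⟨ idᵖ , G ∘ᵖ K ⟩ᵖ) Realizes function f)

𝔹aire : RepresentedSpace
𝔹aire = record
  { setoid     = BaireSetoid
  ; δ          = idᵖ
  ; surjective = λ p → p , λ _ → refl
  }

ℂantor : RepresentedSpace
ℂantor = record
  { setoid     = ℕ →-setoid (Fin 2)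
  ; δ          = record
    { graph       = λ p x → p ≗ toℕ ∘ x
    ; graph-respˡ = λ e h n → trans (sym (e n)) (h n)
    ; graph-respʳ = λ e h n → trans (h n) (cong toℕ (e n))
    ; functional  = λ h h′ n → toℕ-injective (trans (sym (h n)) (h′ n))
    }
  ; surjective = λ x → toℕ ∘ x , λ _ → refl
  }

ℕaturals : RepresentedSpace
ℕaturals = record
  { setoid     = ≡.setoid ℕ
  ; δ          = record
    { graph       = λ p k → p 0 ≡ k
    ; graph-respˡ = λ e h → trans (sym (e 0)) h
    ; graph-respʳ = λ e h → trans h e
    ; functional  = λ h h′ → trans (sym h) h′
    }
  ; surjective = λ k → (λ _ → k) , refl
  }

_−1 : ℕ → List ℕ
zero  −1 = []
suc n −1 = [ n ]

concat−1 : Baire → ℕ → List ℕ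
concat−1 p n = concatMap _−1 (applyUpTo p n)

-- The concatenation of p(0)−1, p(1)−1, … is infinite and equal to r.

_−1≔_ : Baire → Baire → Set
p −1≔ r = (∀ n → concat−1 p n ≡ applyUpTo r (length (concat−1 p n)))
        × (∀ m → ∃[ n ] m < length (concat−1 p n))

applyUpTo-cong : ∀ {A : Set} {f g : ℕ → A} → f ≗ g →
                 ∀ n → applyUpTo f n ≡ applyUpTo g n
applyUpTo-cong e zero    = refl
applyUpTo-cong e (suc n) = cong₂ _∷_ (e 0) (applyUpTo-cong (e ∘ suc) n)

applyUpTo-injective : ∀ {A : Set} (f g : ℕ → A) n →
                      applyUpTo f n ≡ applyUpTo g n → ∀ m → m < n → f m ≡ g m
applyUpTo-injective f g (suc n) e zero    _       = proj₁ (∷-injective e)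
applyUpTo-injective f g (suc n) e (suc m) (s<s l) =
  applyUpTo-injective (f ∘ suc) (g ∘ suc) n (proj₂ (∷-injective e)) m l

−1≔-respˡ : _−1≔_ Respectsˡ _≗_
−1≔-respˡ {r} {p} {p′} e (h , l) = h′ , l′
  where
  same : ∀ n → concat−1 p n ≡ concat−1 p′ n
  same n = cong (concatMap _−1) (applyUpTo-cong e n)
  h′ : ∀ n → concat−1 p′ n ≡ applyUpTo r (length (concat−1 p′ n))
  h′ n = subst (λ w → w ≡ applyUpTo r (length w)) (same n) (h n)
  l′ : ∀ m → ∃[ n ] m < length (concat−1 p′ n)
  l′ m with l m
  ... | n , m< = n , subst (λ w → m < length w) (same n) m<

−1≔-functional : ∀ {p r r′} → p −1≔ r → p −1≔ r′ → r ≗ r′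
−1≔-functional {r = r} {r′} (h , l) (h′ , _) m with l m
... | n , m< = applyUpTo-injective r r′ _ (trans (sym (h n)) (h′ n)) m m<

suc−1≔ : ∀ r → (suc ∘ r) −1≔ r
suc−1≔ r = (λ n → trans (same r n) (cong (applyUpTo r) (sym (len n))))
         , (λ m → suc m , ≤-reflexive (sym (len (suc m))))
  where
  same : ∀ s n → concat−1 (suc ∘ s) n ≡ applyUpTo s n
  same s zero    = refl
  same s (suc n) = cong (s 0 ∷_) (same (s ∘ suc) n)
  len : ∀ n → length (concat−1 (suc ∘ r) n) ≡ n
  len n = trans (cong length (same r n)) (length-applyUpTo r n)

-- The point ⊥ is nothing.

Completion : RepresentedSpace → RepresentedSpace
Completion Y = record
  { setoid     = Maybeᴾ.setoid Y.setoid
  ; δ          = record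
    { graph       = gr
    ; graph-respˡ = λ {y} → gr-respˡ {y}
    ; graph-respʳ = gr-respʳ
    ; functional  = gr-functional
    }
  ; surjective = gr-surjective
  }
  where
  module Y = RepresentedSpace Y
  open Maybeᴾ using (just; nothing)

  gr : Baire → Maybe Y.Carrier → Set
  gr p (just y) = ∃[ r ] p −1≔ r × graph Y.δ r y
  gr p nothing  = ¬ (∃[ r ] ∃[ y ] p −1≔ r × graph Y.δ r y)

  gr-respˡ : gr Respectsˡ _≗_
  gr-respˡ {just y}  e (r , d , h) = r , −1≔-respˡ e d , h
  gr-respˡ {nothing} e ¬h (r , y , d , h) =
    ¬h (r , y , −1≔-respˡ (λ n → sym (e n)) d , h)

  gr-respʳ : gr Respectsʳ (Maybeᴾ.Pointwise Y._≈_)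
  gr-respʳ (just e) (r , d , h) = r , d , graph-respʳ Y.δ e h
  gr-respʳ nothing  h           = h

  gr-functional : ∀ {p y y′} → gr p y → gr p y′ → Maybeᴾ.Pointwise Y._≈_ y y′
  gr-functional {y = just y}  {just y′} (r , d , h) (r′ , d′ , h′) =
    just (functional Y.δ (graph-respˡ Y.δ (−1≔-functional d d′) h) h′)
  gr-functional {y = just y}  {nothing} (r , d , h) ¬h = ⊥-elim (¬h (r , y , d , h))
  gr-functional {y = nothing} {just y}  ¬h (r , d , h) = ⊥-elim (¬h (r , y , d , h))
  gr-functional {y = nothing} {nothing} _ _ = nothing

  empty : ∀ n → concat−1 (λ _ → 0) n ≡ []
  empty zero    = refl
  empty (suc n) = empty n

  gr-surjective : ∀ y → ∃[ p ] gr p y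
  gr-surjective (just y) with Y.surjective y
  ... | r , h = suc ∘ r , r , suc−1≔ r , h
  gr-surjective nothing = (λ _ → 0) , λ (_ , _ , (_ , l) , _) →
    let n , 0< = l 0 in n≮0 (subst (λ w → 0 < length w) (empty n) 0<)

⟨_,_⟩ₙ : ℕ → ℕ → ℕ
⟨ n , k ⟩ₙ = (n + k) * (n + k + 1) / 2 + k

column : Baire → ℕ → Baire
column p n k = p ⟨ n , k ⟩ₙ

private
  next : ℕ × ℕ → ℕ × ℕ
  next (zero  , k) = suc k , 0
  next (suc n , k) = n , suc k

unpair : ℕ → ℕ × ℕ
unpair zero    = 0 , 0
unpair (suc m) = next (unpair m)

private
  tri : ∀ s → suc s * (suc s + 1) / 2 ≡ s * (s + 1) / 2 + suc s
  tri s = begin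
    suc s * (suc s + 1) / 2             ≡⟨ cong (_/ 2) (expand s) ⟩
    (s * (s + 1) + suc s * 2) / 2       ≡⟨ +-distrib-/-∣ʳ (s * (s + 1)) (n∣m*n (suc s)) ⟩
    s * (s + 1) / 2 + suc s * 2 / 2     ≡⟨ cong (s * (s + 1) / 2 +_) (m*n/n≡m (suc s) 2) ⟩
    s * (s + 1) / 2 + suc s             ∎
    where
    open ≡-Reasoning
    expand : ∀ t → suc t * (suc t + 1) ≡ t * (t + 1) + suc t * 2
    expand = solve-∀

  pair-zero : ∀ n → ⟨ suc n , 0 ⟩ₙ ≡ suc ⟨ 0 , n ⟩ₙ
  pair-zero n = begin
    (suc n + 0) * (suc n + 0 + 1) / 2 + 0  ≡⟨ +-identityʳ _ ⟩
    (suc n + 0) * (suc n + 0 + 1) / 2      ≡⟨ cong (λ s → s * (s + 1) / 2) (+-identityʳ (suc n)) ⟩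
    suc n * (suc n + 1) / 2                ≡⟨ tri n ⟩
    n * (n + 1) / 2 + suc n                ≡⟨ +-suc _ n ⟩
    suc (n * (n + 1) / 2 + n)              ∎
    where open ≡-Reasoning

  pair-suc : ∀ n k → ⟨ n , suc k ⟩ₙ ≡ suc ⟨ suc n , k ⟩ₙ
  pair-suc n k = begin
    (n + suc k) * (n + suc k + 1) / 2 + suc k    ≡⟨ cong (λ s → s * (s + 1) / 2 + suc k) (+-suc n k) ⟩
    (suc n + k) * (suc n + k + 1) / 2 + suc k    ≡⟨ +-suc _ k ⟩
    suc ⟨ suc n , k ⟩ₙ                           ∎
    where open ≡-Reasoning

unpair-pair : ∀ n k → unpair ⟨ n , k ⟩ₙ ≡ (n , k)
unpair-pair n k = go (n + k) n k refl
  where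
  go : ∀ s n k → n + k ≡ s → unpair ⟨ n , k ⟩ₙ ≡ (n , k)
  go s n (suc k) e = trans (cong unpair (pair-suc n k))
                      (cong next (go s (suc n) k (trans (sym (+-suc n k)) e)))
  go s       zero    zero _ = refl
  go zero    (suc n) zero ()
  go (suc s) (suc n) zero e =
    trans (cong unpair (pair-zero n))
      (cong next (go s 0 n (suc-injective (trans (cong suc (sym (+-identityʳ n))) e))))

Sequences : RepresentedSpace → RepresentedSpace
Sequences X = record
  { setoid     = record
    { Carrier       = ℕ → X.Carrier
    ; _≈_           = λ x y → ∀ n → x n X.≈ y n
    ; isEquivalence = record
      { refl  = λ _ → X.refl
      ; sym   = λ e n → X.sym (e n)
      ; trans = λ e e′ n → X.trans (e n) (e′ n)
      }
    }
  ; δ          = record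
    { graph       = λ p x → ∀ n → graph X.δ (column p n) (x n)
    ; graph-respˡ = λ e h n → graph-respˡ X.δ (λ k → e ⟨ n , k ⟩ₙ) (h n)
    ; graph-respʳ = λ e h n → graph-respʳ X.δ (e n) (h n)
    ; functional  = λ h h′ n → functional X.δ (h n) (h′ n)
    }
  ; surjective = λ x →
      (λ m → let n , k = unpair m in proj₁ (X.surjective (x n)) k) ,
      λ n → graph-respˡ X.δ
        (λ k → cong (λ (n , k) → proj₁ (X.surjective (x n)) k) (sym (unpair-pair n k)))
        (proj₂ (X.surjective (x n)))
  }
  where module X = RepresentedSpace X

stash : ∀ {X Y} → X ⇉ Y → Sequences X ⇉ Sequences (Completion Y)
stash {X} {Y} f = record
  { dom         = λ x → ∀ n → dom f (x n)
  ; value       = λ x y → ∃[ n ] ∃[ z ] y n Ȳ.≈ just z × value f (x n) z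
  ; dom-resp    = λ e d n → dom-resp f (e n) (d n)
  ; value-respˡ = λ e (n , z , y≈z , v) → n , z , y≈z , value-respˡ f (e n) v
  ; value-respʳ = λ e (n , z , y≈z , v) → n , z , Ȳ.trans (Ȳ.sym (e n)) y≈z , v
  }
  where module Ȳ = RepresentedSpace (Completion Y)

-- Every component of the answer is the given answer to the 0th instance.

Stash : Problem → Problem
Stash f = record { function = stash (function f) ; realizer = Ḡ , realizes }
  where
  F = proj₁ (realizer f)
  module Ȳ = RepresentedSpace (Completion (target f))

  answer : Baire → Baire
  answer r m = suc (r (proj₂ (unpair m)))

  Ḡ : Baire⇀Baire
  Ḡ .graph p q = ∃[ r ] graph F (column p 0) r × q ≗ answer r
  Ḡ .graph-respˡ e (r , h , e′) = r , graph-respˡ F (λ k → e ⟨ 0 , k ⟩ₙ) h , e′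
  Ḡ .graph-respʳ e (r , h , e′) = r , h , λ n → trans (sym (e n)) (e′ n)
  Ḡ .functional (r , h , e) (r′ , h′ , e′) n =
    trans (e n) (trans (cong suc (functional F h h′ _)) (sym (e′ n)))

  realizes : Ḡ Realizes stash (function f)
  realizes p x d ds with proj₂ (realizer f) (column p 0) (x 0) (d 0) (ds 0)
  ... | r , y , Fr , δry , v =
    answer r , (λ _ → just y) , (r , Fr , λ _ → refl) ,
    (λ n → r , −1≔-respˡ (λ k → cong (suc ∘ r ∘ proj₂) (sym (unpair-pair n k))) (suc−1≔ r) , δry) ,
    0 , y , Ȳ.refl , v

_⟶_ : Baire → ℕ → Set
p ⟶ l = ∃[ m ] ∀ n → m ≤ n → p n ≡ l

⟶-resp : ∀ {p p′ l} → p ≗ p′ → p ⟶ l → p′ ⟶ l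
⟶-resp e (m , h) = m , λ n m≤n → trans (sym (e n)) (h n m≤n)

⟶-unique : ∀ {p l l′} → p ⟶ l → p ⟶ l′ → l ≡ l′
⟶-unique (m , h) (m′ , h′) =
  trans (sym (h (m ⊔ m′) (m≤m⊔n m m′))) (h′ (m ⊔ m′) (m≤n⊔m m m′))

nlim : 𝔹aire ⇉ ℕaturals
nlim = record
  { dom         = λ p → ∃[ l ] p ⟶ l
  ; value       = λ p k → ¬ (p ⟶ k)
  ; dom-resp    = λ e (l , h) → l , ⟶-resp e h
  ; value-respˡ = λ e ¬h h → ¬h (⟶-resp (λ n → sym (e n)) h)
  ; value-respʳ = λ { refl ¬h → ¬h }
  }

NLIM : Problem
NLIM = record { function = nlim ; realizer = F , realizes }
  where
  F : Baire⇀Baire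
  F .graph p q = ∃[ l ] p ⟶ l × (∀ n → q n ≡ suc l)
  F .graph-respˡ e (l , h , e′) = l , ⟶-resp e h , e′
  F .graph-respʳ e (l , h , e′) = l , h , λ n → trans (sym (e n)) (e′ n)
  F .functional (l , h , e) (l′ , h′ , e′) n =
    trans (e n) (trans (cong suc (⟶-unique h h′)) (sym (e′ n)))

  realizes : F Realizes nlim
  realizes p x p≗x (l , h) =
    (λ _ → suc l) , suc l , (l , ⟶-resp (λ n → sym (p≗x n)) h , λ _ → refl) , refl ,
    λ h′ → 1+n≢n (⟶-unique h′ h)

Word : Set
Word = List (Fin 2)

record Tree : Set where
  field
    χ             : Word → Bool
    prefix-closed : ∀ u v → χ (u ++ v) ≡ true → χ u ≡ true

open Tree public

infix 4 _∈ᵗ_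

_∈ᵗ_ : Word → Tree → Set
w ∈ᵗ T = χ T w ≡ true

Infinite : Tree → Set
Infinite T = ∀ (L : List Word) → ∃[ w ] w ∈ᵗ T × w ∉ L

-- x ∈ [T], the set of infinite paths

_IsPathOf_ : (ℕ → Fin 2) → Tree → Set
x IsPathOf T = ∀ n → applyUpTo x n ∈ᵗ T

-- Bijective base-2 numeration identifies {0,1}* with ℕ.

private
  toℕᵇ : Word → ℕᵇ
  toℕᵇ []       = ℕᵇ.zero
  toℕᵇ (0F ∷ w) = 1+[2 toℕᵇ w ]
  toℕᵇ (1F ∷ w) = 2[1+ toℕᵇ w ]

  fromℕᵇ : ℕᵇ → Word
  fromℕᵇ ℕᵇ.zero  = []
  fromℕᵇ 1+[2 b ] = 0F ∷ fromℕᵇ b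
  fromℕᵇ 2[1+ b ] = 1F ∷ fromℕᵇ b

  fromℕᵇ-toℕᵇ : ∀ w → fromℕᵇ (toℕᵇ w) ≡ w
  fromℕᵇ-toℕᵇ []       = refl
  fromℕᵇ-toℕᵇ (0F ∷ w) = cong (0F ∷_) (fromℕᵇ-toℕᵇ w)
  fromℕᵇ-toℕᵇ (1F ∷ w) = cong (1F ∷_) (fromℕᵇ-toℕᵇ w)

encode : Word → ℕ
encode w = ℕᵇ.toℕ (toℕᵇ w)

decode : ℕ → Word
decode n = fromℕᵇ (ℕᵇ.fromℕ n)

decode-encode : ∀ w → decode (encode w) ≡ w
decode-encode w = trans (cong fromℕᵇ (fromℕ-toℕ (toℕᵇ w))) (fromℕᵇ-toℕᵇ w)

bit : Bool → ℕ
bit b = if b then 1 else 0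

bit-injective : ∀ {b b′} → bit b ≡ bit b′ → b ≡ b′
bit-injective {true}  {true}  _ = refl
bit-injective {false} {false} _ = refl

Trees : RepresentedSpace
Trees = record
  { setoid     = record
    { Carrier       = Tree
    ; _≈_           = λ S T → χ S ≗ χ T
    ; isEquivalence = record
      { refl  = λ _ → refl
      ; sym   = λ e w → sym (e w)
      ; trans = λ e e′ w → trans (e w) (e′ w)
      }
    }
  ; δ          = record
    { graph       = λ p T → ∀ w → p (encode w) ≡ bit (χ T w)
    ; graph-respˡ = λ e h w → trans (sym (e (encode w))) (h w)
    ; graph-respʳ = λ e h w → trans (h w) (cong bit (e w))
    ; functional  = λ h h′ w → bit-injective (trans (sym (h w)) (h′ w))
    }
  ; surjective = λ T → (λ n → bit (χ T (decode n))) ,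
                       λ w → cong (bit ∘ χ T) (decode-encode w)
  }

Infinite-resp : ∀ {S T} → χ S ≗ χ T → Infinite S → Infinite T
Infinite-resp e inf L with inf L
... | w , w∈S , w∉L = w , trans (sym (e w)) w∈S , w∉L

wkl : Trees ⇉ ℂantor
wkl = record
  { dom         = Infinite
  ; value       = λ T x → x IsPathOf T
  ; dom-resp    = λ {S} {T} → Infinite-resp {S} {T}
  ; value-respˡ = λ e h n → trans (sym (e _)) (h n)
  ; value-respʳ = λ {T} e h n → trans (cong (χ T) (sym (applyUpTo-cong e n))) (h n)
  }

-- A realizer of wkl need not be computable, so its existence depends on
-- excluded middle; the one given here takes the leftmost path.  The
-- definition of _≤W_ does not depend on which realizer is given.

module _ (em : ExcludedMiddle 0ℓ) where

  private
    Extends : Tree → Word → ℕ → Set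
    Extends T w m = ∃[ v ] m ≤ length v × (w ++ v) ∈ᵗ T

    Extendible : Tree → Word → Set
    Extendible T w = ∀ m → Extends T w m

    Extendible-resp : ∀ {S T} → χ S ≗ χ T → ∀ {w} → Extendible S w → Extendible T w
    Extendible-resp e ext m with ext m
    ... | v , m≤ , ∈S = v , m≤ , trans (sym (e _)) ∈S

    words< : ℕ → List Word
    words< zero    = []
    words< (suc m) = [] ∷ map (0F ∷_) (words< m) ++ map (1F ∷_) (words< m)

    ∈words< : ∀ m w → length w < m → w ∈ words< m
    ∈words< (suc m) []       _       = here refl
    ∈words< (suc m) (0F ∷ w) (s<s l) =
      there (∈-++⁺ˡ (∈-map⁺ (0F ∷_) (∈words< m w l)))
    ∈words< (suc m) (1F ∷ w) (s<s l) =
      there (∈-++⁺ʳ (map (0F ∷_) (words< m)) (∈-map⁺ (1F ∷_) (∈words< m w l)))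

    root : ∀ T → Infinite T → Extendible T []
    root T inf m with inf (words< m)
    ... | w , w∈T , w∉ = w , ≮⇒≥ (λ l → w∉ (∈words< m w l)) , w∈T

    ¬Extendible : ∀ T w → ¬ Extendible T w → ∃[ m ] ¬ Extends T w m
    ¬Extendible T w ¬ext with em {∃[ m ] ¬ Extends T w m}
    ... | yes h = h
    ... | no ¬h = ⊥-elim (¬ext λ m → dne m em)
      where
      dne : ∀ m → Dec (Extends T w m) → Extends T w m
      dne m (yes h) = h
      dne m (no ¬e) = ⊥-elim (¬h (m , ¬e))

    snoc : ∀ T (w : Word) b v → (w ++ b ∷ v) ∈ᵗ T → (w ∷ʳ b ++ v) ∈ᵗ T
    snoc T w b v = subst (_∈ᵗ T) (sym (++-assoc w [ b ] v))

    right : ∀ T w → Extendible T w → ¬ Extendible T (w ∷ʳ 0F) → Extendible T (w ∷ʳ 1F)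
    right T w ext ¬l m with ¬Extendible T (w ∷ʳ 0F) ¬l
    ... | k , ¬k with ext (suc (k ⊔ m))
    ...   | 0F ∷ v , s≤s l , h = ⊥-elim (¬k (v , ≤-trans (m≤m⊔n k m) l , snoc T w 0F v h))
    ...   | 1F ∷ v , s≤s l , h = v , ≤-trans (m≤n⊔m k m) l , snoc T w 1F v h

    direction : Tree → Word → Fin 2
    direction T w = if does (em {Extendible T (w ∷ʳ 0F)}) then 0F else 1F

    step : ∀ T w → Extendible T w → Extendible T (w ∷ʳ direction T w)
    step T w ext with em {Extendible T (w ∷ʳ 0F)}
    ... | yes l = l
    ... | no ¬l = right T w ext ¬l

    node : Tree → ℕ → Word
    node T zero    = []
    node T (suc n) = node T n ∷ʳ direction T (node T n)

  leftmost : Tree → ℕ → Fin 2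
  leftmost T n = direction T (node T n)

  private
    applyUpTo-leftmost : ∀ T n → applyUpTo (leftmost T) n ≡ node T n
    applyUpTo-leftmost T zero    = refl
    applyUpTo-leftmost T (suc n) =
      trans (sym (applyUpTo-∷ʳ (leftmost T) n))
            (cong (_∷ʳ leftmost T n) (applyUpTo-leftmost T n))

    node-extendible : ∀ T → Infinite T → ∀ n → Extendible T (node T n)
    node-extendible T inf zero    = root T inf
    node-extendible T inf (suc n) = step T (node T n) (node-extendible T inf n)

    direction-cong : ∀ {S T} → χ S ≗ χ T → ∀ w → direction S w ≡ direction T w
    direction-cong {S} {T} e w = cong (if_then 0F else 1F)
      (does-⇔ (mk⇔ (Extendible-resp {S} {T} e) (Extendible-resp {T} {S} (λ v → sym (e v)))) em em)

    node-cong : ∀ {S T} → χ S ≗ χ T → ∀ n → node S n ≡ node T n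
    node-cong         e zero    = refl
    node-cong {S} {T} e (suc n) = cong₂ _∷ʳ_ (node-cong {S} {T} e n)
      (trans (cong (direction S) (node-cong {S} {T} e n)) (direction-cong {S} {T} e (node T n)))

  leftmost-path : ∀ T → Infinite T → leftmost T IsPathOf T
  leftmost-path T inf n with node-extendible T inf n 0
  ... | v , _ , h = trans (cong (χ T) (applyUpTo-leftmost T n))
                          (prefix-closed T (node T n) v h)

  leftmost-cong : ∀ {S T} → χ S ≗ χ T → leftmost S ≗ leftmost T
  leftmost-cong {S} {T} e n =
    trans (cong (direction S) (node-cong {S} {T} e n)) (direction-cong {S} {T} e (node T n))

  WKL : Problem
  WKL = record { function = wkl ; realizer = F , realizes }
    where
    module Tr = RepresentedSpace Trees

    F : Baire⇀Baire
    F .graph p q = ∃[ T ] graph Tr.δ p T × q ≗ toℕ ∘ leftmost T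
    F .graph-respˡ {q} {p} {p′} e (T , h , e′) =
      T , graph-respˡ Tr.δ {T} {p} {p′} e h , e′
    F .graph-respʳ e (T , h , e′) = T , h , λ n → trans (sym (e n)) (e′ n)
    F .functional {p} (T , h , e) (T′ , h′ , e′) n =
      trans (e n) (trans (cong toℕ (leftmost-cong {T} {T′} (functional Tr.δ {p} {T} {T′} h h′) n))
                         (sym (e′ n)))

    realizes : F Realizes wkl
    realizes p T h inf =
      toℕ ∘ leftmost T , leftmost T , (T , h , λ _ → refl) , (λ _ → refl) , leftmost-path T inf

{-# OPTIONS --safe #-}

-- Only the continuity of H and K is used.  By forcing we build an instance p,
-- all of whose columns converge, and a path of the tree K(p) on which no answer
-- of H is right.  A condition (N , s , p) fixes p below s and the first N
-- columns of p; it is kept such that every instance p′ satisfying it has a path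
-- of K(p′) whose answers in the columns below N are all absent or equal to the
-- limits of these columns.  If no extension of the condition did the same for
-- column N, one could let this column tend to 0, then to 1, and so on, each time
-- only until a finite part of p refutes, by compactness, all paths that answer
-- that number.  The first round bounds the possible answers, so after finitely
-- many rounds no path is left, which is a contradiction.  A last use of
-- compactness gives a path that works for all N at once.

module Submission where

open import Defs
open import Axiom.ExcludedMiddle using (ExcludedMiddle)
open import Data.Bool.Base using (true; false; if_then_else_)
open import Data.Empty using (⊥; ⊥-elim)
open import Data.Fin.Base using (Fin; toℕ)
open import Data.Fin.Patterns using (0F; 1F)
open import Data.List.Base using ([]; _∷_; applyUpTo; length)
open import Data.List.Properties using (∷-injectiveˡ)
open import Data.Maybe.Base using (just)
open import Data.Maybe.Relation.Binary.Pointwise using (just)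
open import Data.Nat.Base
open import Data.Nat.DivMod using (_/_; _%_; m/n≤m)
open import Data.Nat.Properties
open import Data.Product using (∃-syntax; _×_; _,_; proj₁; proj₂)
open import Data.Sum.Base using (_⊎_; inj₁; inj₂; [_,_]′; map₁; map₂)
open import Data.Vec.Base using (Vec; []; _∷_)
import Data.Vec.Properties as Vecᴾ
open import Function.Base using (_∘_)
open import Level using (0ℓ)
open import Relation.Binary.Definitions using (tri<; tri≈; tri>)
open import Relation.Binary.PropositionalEquality
  using (_≡_; _≢_; _≗_; refl; sym; trans; cong; cong₂; subst)
open import Relation.Nullary using (¬_; yes; no; does; contradiction)
open import Relation.Nullary.Decidable using (decidable-stable)

-- Cantor space and agreement below a bound.

Cantor : Set
Cantor = ℕ → Fin 2

infix 4 _≗[_]_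

_≗[_]_ : ∀ {A : Set} → (ℕ → A) → ℕ → (ℕ → A) → Set
f ≗[ m ] g = ∀ i → i < m → f i ≡ g i

≗[]-weaken : ∀ {A : Set} {f g : ℕ → A} {m n} → m ≤ n → f ≗[ n ] g → f ≗[ m ] g
≗[]-weaken m≤n a i i<m = a i (<-≤-trans i<m m≤n)

-- Continuity and determinism of oracle computations

Open : (Baire → Set) → Set
Open U = ∀ p → U p → ∃[ m ] ∀ p′ → p ≗[ m ] p′ → U p′

open-∃ : ∀ {I : Set} {U : I → Baire → Set} →
         (∀ i → Open (U i)) → Open (λ p → ∃[ i ] U i p)
open-∃ o p (i , u) with o i p u
... | m , h = m , λ p′ a → i , h p′ a

open-× : ∀ {U W : Baire → Set} → Open U → Open W → Open (λ p → U p × W p)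
open-× o o′ p (u , w) with o p u | o′ p w
... | m , h | m′ , h′ = m ⊔ m′ , λ p′ a →
  h p′ (≗[]-weaken (m≤m⊔n m m′) a) , h′ p′ (≗[]-weaken (m≤n⊔m m m′) a)

open-∀< : ∀ {U : ℕ → Baire → Set} → (∀ j → Open (U j)) →
          ∀ n → Open (λ p → ∀ j → j < n → U j p)
open-∀< o zero    p u = 0 , λ _ _ _ ()
open-∀< {U} o (suc n) p u
  with o n p (u n ≤-refl) | open-∀< {U} o n p (λ j l → u j (m<n⇒m<1+n l))
... | m , h | m′ , h′ = m ⊔ m′ , λ p′ a j j<1+n →
  [ (λ j<n → h′ p′ (≗[]-weaken (m≤n⊔m m m′) a) j j<n)
  , (λ { refl → h p′ (≗[]-weaken (m≤m⊔n m m′) a) })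
  ]′ (m≤n⇒m<n∨m≡n (s≤s⁻¹ j<1+n))

open-const : ∀ {A : Set} → Open (λ _ → A)
open-const p u = 0 , λ _ _ → u

PrecGraph-open : ∀ {base : Baire → ℕ → Set} {step : Baire → ℕ → ℕ → ℕ → Set} →
                 (∀ y → Open (λ p → base p y)) →
                 (∀ j r y → Open (λ p → step p j r y)) →
                 ∀ k y → Open (λ p → PrecGraph (base p) (step p) k y)
PrecGraph-open b s zero    y = b y
PrecGraph-open {base} {step} b s (suc k) y =
  open-∃ λ r → open-× (PrecGraph-open {base} {step} b s k r) (s k r y)

mutual
  -- A halting computation has consulted only finitely many oracle values; `min` asks only finitely
  -- many smaller arguments to halt.
  eval-open : ∀ {n} (c : Code n) xs y → Open (λ p → ⟦ c ⟧ p xs y)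
  eval-open zero        xs       y = open-const
  eval-open succ        (x ∷ []) y = open-const
  eval-open oracle      (x ∷ []) y p e = suc x , λ p′ a → trans (sym (a x ≤-refl)) e
  eval-open (proj i)    xs       y = open-const
  eval-open (comp c ds) xs       y =
    open-∃ λ zs → open-× (evals-open ds xs zs) (eval-open c zs y)
  eval-open (prec c d)  (k ∷ xs) y =
    PrecGraph-open {λ p → ⟦ c ⟧ p xs} {λ p j r → ⟦ d ⟧ p (j ∷ r ∷ xs)}
      (eval-open c xs) (λ j r → eval-open d (j ∷ r ∷ xs)) k y
  eval-open (min c)     xs       y =
    open-× (eval-open c (y ∷ xs) 0)
           (open-∀< (λ j → open-∃ λ z → eval-open c (j ∷ xs) (suc z)) y)

  evals-open : ∀ {m n} (ds : Vec (Code n) m) xs zs → Open (λ p → ⟦ ds ⟧* p xs zs)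
  evals-open []       xs []       = open-const
  evals-open (d ∷ ds) xs (z ∷ zs) = open-× (eval-open d xs z) (evals-open ds xs zs)

PrecGraph-functional : ∀ {base : ℕ → Set} {step : ℕ → ℕ → ℕ → Set} →
                       (∀ {y y′} → base y → base y′ → y ≡ y′) →
                       (∀ {j r y y′} → step j r y → step j r y′ → y ≡ y′) →
                       ∀ k {y y′} → PrecGraph base step k y → PrecGraph base step k y′ → y ≡ y′
PrecGraph-functional b s zero    h h′ = b h h′
PrecGraph-functional b s (suc k) (r , g , h) (r′ , g′ , h′)
  with PrecGraph-functional b s k g g′
... | refl = s h h′

mutual
  eval-functional : ∀ {n} (c : Code n) {p xs y y′} →
                    ⟦ c ⟧ p xs y → ⟦ c ⟧ p xs y′ → y ≡ y′
  eval-functional zero        h h′ = trans (sym h) h′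
  eval-functional succ   {xs = _ ∷ []} h h′ = trans (sym h) h′
  eval-functional oracle {xs = _ ∷ []} h h′ = trans (sym h) h′
  eval-functional (proj i)    h h′ = trans (sym h) h′
  eval-functional (comp c ds) (zs , g , h) (zs′ , g′ , h′)
    with evals-functional ds g g′
  ... | refl = eval-functional c h h′
  eval-functional (prec c d) {xs = k ∷ xs} h h′ =
    PrecGraph-functional (eval-functional c) (eval-functional d) k h h′
  eval-functional (min c) {y = y} {y′} (h , l) (h′ , l′) with <-cmp y y′
  ... | tri≈ _ y≡y′ _ = y≡y′
  ... | tri< y<y′ _ _ = contradiction (eval-functional c h (proj₂ (l′ y y<y′))) 0≢1+n
  ... | tri> _ _ y′<y = contradiction (eval-functional c h′ (proj₂ (l y′ y′<y))) 0≢1+n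

  evals-functional : ∀ {m n} (ds : Vec (Code n) m) {p xs zs zs′} →
                     ⟦ ds ⟧* p xs zs → ⟦ ds ⟧* p xs zs′ → zs ≡ zs′
  evals-functional []       {zs = []}    {[]}    _       _         = refl
  evals-functional (d ∷ ds) {zs = _ ∷ _} {_ ∷ _} (h , g) (h′ , g′) =
    cong₂ _∷_ (eval-functional d h h′) (evals-functional ds g g′)

-- Compactness of Cantor space

-- The newest bit comes first, so that the children of a node `w` are `0F ∷ w` and `1F ∷ w`.
_↾_ : Cantor → ∀ n → Vec (Fin 2) n
x ↾ zero  = []
x ↾ suc n = x n ∷ x ↾ n

↾-injective : ∀ {x x′} n → x ↾ n ≡ x′ ↾ n → x ≗[ n ] x′
↾-injective (suc n) e i i<1+n =
  [ ↾-injective n (Vecᴾ.∷-injectiveʳ e) i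
  , (λ { refl → Vecᴾ.∷-injectiveˡ e })
  ]′ (m≤n⇒m<n∨m≡n (s≤s⁻¹ i<1+n))

module Compactness (em : ExcludedMiddle 0ℓ) (V : ℕ → Cantor → Set)
                   (mono : ∀ {m n x} → m ≤ n → V m x → V n x) where

  Covered : ∀ {n} → Vec (Fin 2) n → Set
  Covered {n} w = ∃[ m ] ∀ x → x ↾ n ≡ w → V m x

  covered-split : ∀ {n} (w : Vec (Fin 2) n) →
                  Covered (0F ∷ w) → Covered (1F ∷ w) → Covered w
  covered-split {n} w (m , h) (m′ , h′) = m ⊔ m′ , go
    where
    go : ∀ x → x ↾ n ≡ w → V (m ⊔ m′) x
    go x e with x n in eq
    ... | 0F = mono (m≤m⊔n m m′) (h x (cong₂ _∷_ eq e))
    ... | 1F = mono (m≤n⊔m m m′) (h′ x (cong₂ _∷_ eq e))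

  direction : ∀ {n} → Vec (Fin 2) n → Fin 2
  direction w = if does (em {Covered (0F ∷ w)}) then 1F else 0F

  node : ∀ n → Vec (Fin 2) n
  node zero    = []
  node (suc n) = direction (node n) ∷ node n

  step-uncovered : ∀ {n} (w : Vec (Fin 2) n) → ¬ Covered w → ¬ Covered (direction w ∷ w)
  step-uncovered w ¬c with em {Covered (0F ∷ w)}
  ... | yes c₀ = λ c₁ → ¬c (covered-split w c₀ c₁)
  ... | no ¬c₀ = ¬c₀

  node-uncovered : ¬ Covered [] → ∀ n → ¬ Covered (node n)
  node-uncovered ¬c zero    = ¬c
  node-uncovered ¬c (suc n) = step-uncovered (node n) (node-uncovered ¬c n)

  path : Cantor
  path n = direction (node n)

  path-↾ : ∀ n → path ↾ n ≡ node n
  path-↾ zero    = refl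
  path-↾ (suc n) = cong (path n ∷_) (path-↾ n)

  -- If the root is uncovered, then, since an uncovered node has an uncovered child, all prefixes of
  -- `path` are uncovered; but `cover path` covers one of them.
  compactness : (∀ x → ∃[ m ] ∀ x′ → x ≗[ m ] x′ → V m x′) → ∃[ m ] ∀ x → V m x
  compactness cover with em {Covered []}
  ... | yes (m , h) = m , λ x → h x refl
  ... | no ¬c with cover path
  ...   | m , h = ⊥-elim (node-uncovered ¬c m
                    (m , λ x e → h x (↾-injective m (trans (path-↾ m) (sym e)))))

open Compactness using (compactness)

-- The forcing construction

col : ℕ → ℕ
col i = proj₁ (unpair i)

col-pair : ∀ n k → col ⟨ n , k ⟩ₙ ≡ n
col-pair n k = cong proj₁ (unpair-pair n k)

Dom : Baire → Set
Dom p = ∀ n → ∃[ l ] column p n ⟶ l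

Agree : ℕ → ℕ → Baire → Baire → Set
Agree N s p p′ = ∀ i → i < s ⊎ col i < N → p i ≡ p′ i

Agree-refl : ∀ {N s p} → Agree N s p p
Agree-refl _ _ = refl

Agree-trans : ∀ {N s p q r} → Agree N s p q → Agree N s q r → Agree N s p r
Agree-trans a b i d = trans (a i d) (b i d)

Agree-weaken : ∀ {N N′ s s′ p q} → N ≤ N′ → s ≤ s′ → Agree N′ s′ p q → Agree N s p q
Agree-weaken N≤ s≤ a i d =
  a i (map₁ (λ i<s → <-≤-trans i<s s≤) (map₂ (λ c<N → <-≤-trans c<N N≤) d))

Agree⇒≗[] : ∀ {N s p q} → Agree N s p q → p ≗[ s ] q
Agree⇒≗[] a i i<s = a i (inj₁ i<s)

Agree-column : ∀ {N s p q n} → n < N → Agree N s p q → column p n ≗ column q n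
Agree-column {n = n} n<N a k = a _ (inj₂ (subst (_< _) (sym (col-pair n k)) n<N))

Agree-⟶ : ∀ {N s p q n l} → n < N → Agree N s p q → column p n ⟶ l → column q n ⟶ l
Agree-⟶ n<N a = ⟶-resp (Agree-column n<N a)

Agree-⟶⁻ : ∀ {N s p q n l} → n < N → Agree N s p q → column q n ⟶ l → column p n ⟶ l
Agree-⟶⁻ n<N a = ⟶-resp (sym ∘ Agree-column n<N a)

-- Entries below `s` stay, so every condition of size `s` that leaves column `N` free is still
-- satisfied.
setColumn : ℕ → ℕ → ℕ → Baire → Baire
setColumn N s k p i with i <? s | col i ≟ N
... | no _ | yes _ = k
... | _    | _     = p i

setColumn-agree : ∀ N s k p → Agree N s p (setColumn N s k p)
setColumn-agree N s k p i d with i <? s | col i ≟ N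
... | yes _  | yes _ = refl
... | yes _  | no _  = refl
... | no _   | no _  = refl
... | no i≮s | yes e = ⊥-elim ([ i≮s , (λ c<N → <⇒≢ c<N e) ]′ d)

setColumn-≢ : ∀ N s k p i → col i ≢ N → p i ≡ setColumn N s k p i
setColumn-≢ N s k p i c≢N with i <? s | col i ≟ N
... | yes _ | yes _ = refl
... | yes _ | no _  = refl
... | no _  | no _  = refl
... | no _  | yes e = contradiction e c≢N

setColumn-≡ : ∀ N s k p i → s ≤ i → col i ≡ N → setColumn N s k p i ≡ k
setColumn-≡ N s k p i s≤i e with i <? s | col i ≟ N
... | no _    | yes _  = refl
... | yes i<s | _      = contradiction s≤i (<⇒≱ i<s)
... | no _    | no c≢N = contradiction e c≢N

setColumn-⟶ : ∀ N s k p → column (setColumn N s k p) N ⟶ k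
setColumn-⟶ N s k p = s , λ j s≤j →
  setColumn-≡ N s k p ⟨ N , j ⟩ₙ (≤-trans s≤j (m≤n+m j _)) (col-pair N j)

setColumn-dom : ∀ N s k {p} → Dom p → Dom (setColumn N s k p)
setColumn-dom N s k {p} d n with n ≟ N
... | yes refl = k , setColumn-⟶ N s k p
... | no n≢N   = proj₁ (d n) , ⟶-resp
  (λ j → setColumn-≢ N s k p ⟨ n , j ⟩ₙ (n≢N ∘ trans (sym (col-pair n j)))) (proj₂ (d n))

Open₂ : (Baire → Cantor → Set) → Set
Open₂ U = ∀ p x → U p x → ∃[ m ] ∀ p′ x′ → p ≗[ m ] p′ → x ≗[ m ] x′ → U p′ x′

module Forcing
  (em : ExcludedMiddle 0ℓ)
  (Out : Baire → Cantor → Set)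
  (Says : ℕ → ℕ → Baire → Cantor → Set)
  (Out-open : Open₂ Out)
  (Says-open : ∀ n k → Open₂ (Says n k))
  (Says-functional : ∀ n p x {k k′} → Says n k p x → Says n k′ p x → k ≡ k′)
  where

  -- The sequences to be excluded: those that leave the tree, and those on which a column below `N`
  -- receives a right answer.
  Solved : ℕ → Baire → Cantor → Set
  Solved N p x =
    Out p x ⊎ ∃[ n ] ∃[ k ] n < N × Says n k p x × ¬ (column p n ⟶ k)

  -- No finite part of `p` decides the limit of a column. Hence `Agree N m`, which keeps the columns
  -- below `N` entire.
  Solved-open : ∀ {N p x} → Solved N p x →
    ∃[ m ] ∀ p′ x′ → Agree N m p p′ → x ≗[ m ] x′ → Solved N p′ x′
  Solved-open (inj₁ o) with Out-open _ _ o
  ... | m , h = m , λ p′ x′ a b → inj₁ (h p′ x′ (Agree⇒≗[] a) b)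
  Solved-open (inj₂ (n , k , n<N , s , ¬l)) with Says-open n k _ _ s
  ... | m , h = m , λ p′ x′ a b →
    inj₂ (n , k , n<N , h p′ x′ (Agree⇒≗[] a) b , ¬l ∘ Agree-⟶⁻ n<N a)

  Forced : ℕ → ℕ → Baire → Set
  Forced N s p = ∀ p′ → Dom p′ → Agree N s p p′ → ∃[ x ] ¬ Solved N p′ x

  Extension : ℕ → ℕ → Baire → Set
  Extension N s p =
    ∃[ p′ ] ∃[ s′ ] Dom p′ × s < s′ × Agree N s p p′ × Forced (suc N) s′ p′

  ¬Forced⇒solved : ∀ {N s p} → ¬ Forced N s p →
    ∃[ p′ ] Dom p′ × Agree N s p p′ × (∀ x → Solved N p′ x)
  ¬Forced⇒solved {N} {s} {p} ¬f = decidable-stable em λ ¬h → ¬f λ p′ d a →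
    decidable-stable em λ ¬x → ¬h (p′ , d , a , λ x →
      decidable-stable em λ ¬s → ¬x (x , ¬s))

  -- The limit of column `N` is not mentioned, so this depends only on the condition `(N , s , p)`,
  -- and the column may later be given another limit.
  Refuted : (ℕ → Set) → ℕ → ℕ → Baire → Cantor → Set
  Refuted R N s p x = ∀ p′ → Agree N s p p′ →
    Solved N p′ x ⊎ ∃[ k ] R k × Says N k p′ x

  module Step {N s p} (p-dom : Dom p) (¬ext : ¬ Extension N s p) where

    State : (ℕ → Set) → Set
    State R = ∃[ p′ ] ∃[ s′ ] s ≤ s′ × Dom p′ × Agree N s p p′ × (∀ x → Refuted R N s′ p′ x)

    -- Column `N` is sent to `k`. The enlarged condition is not forced, so some `p₁` satisfying it
    -- has every `x` solved; a right answer in column `N` is then not `k`. Compactness reduces this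
    -- to a finite part of `p₁`.
    advance : ∀ p₀ s₀ → s ≤ s₀ → Dom p₀ → Agree N s p p₀ → ∀ k →
      ∃[ p₁ ] ∃[ s₁ ] Dom p₁ × s₀ ≤ s₁ × Agree N s₀ p₀ p₁ ×
        (∀ x → Refuted (λ k′ → k′ ≢ k × k′ < s₁) N s₁ p₁ x)
    advance p₀ s₀ s≤s₀ d₀ a₀ k
      -- `suc s₀`, because an extension must have size strictly above `s`.
      with ¬Forced⇒solved {suc N} {suc s₀} {setColumn N s₀ k p₀} (λ f →
             ¬ext (_ , suc s₀ , setColumn-dom N s₀ k d₀ , s≤s s≤s₀ ,
                   Agree-trans a₀ (Agree-weaken ≤-refl s≤s₀ (setColumn-agree N s₀ k p₀)) , f))
    ... | p₁ , d₁ , a₁ , solved = result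
      where
      -- One index bounds both the part of `p₁` used and the answers, so that compactness yields
      -- both bounds at once.
      V : ℕ → Cantor → Set
      V m = Refuted (λ k′ → k′ ≢ k × k′ < m) N m p₁

      V-mono : ∀ {m n x} → m ≤ n → V m x → V n x
      V-mono m≤n v p′ a = map₂
        (λ (k′ , (k′≢k , k′<m) , h) → k′ , (k′≢k , <-≤-trans k′<m m≤n) , h)
        (v p′ (Agree-weaken ≤-refl m≤n a))

      column-⟶ : column p₁ N ⟶ k
      column-⟶ = Agree-⟶ ≤-refl a₁ (setColumn-⟶ N s₀ k p₀)

      solved-below : ∀ {x} → Solved N p₁ x → ∃[ m ] ∀ x′ → x ≗[ m ] x′ → V m x′
      solved-below h with Solved-open h
      ... | m , g = m , λ x′ b p′ a → inj₁ (g p′ x′ a b)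

      cover : ∀ x → ∃[ m ] ∀ x′ → x ≗[ m ] x′ → V m x′
      cover x with solved x
      ... | inj₁ o = solved-below (inj₁ o)
      ... | inj₂ (n , k′ , n<1+N , h , ¬l) with m≤n⇒m<n∨m≡n (s≤s⁻¹ n<1+N)
      ...   | inj₁ n<N = solved-below (inj₂ (n , k′ , n<N , h , ¬l))
      ...   | inj₂ refl with Says-open N k′ _ _ h
      -- `suc k′` keeps the answer below the index.
      ...     | m , g = m ⊔ suc k′ , λ x′ b p′ a → inj₂
        (k′ , ((λ { refl → ¬l column-⟶ }) , m≤n⊔m m (suc k′)) ,
         g p′ x′ (≗[]-weaken (m≤m⊔n m _) (Agree⇒≗[] a)) (≗[]-weaken (m≤m⊔n m _) b))

      result : ∃[ p₁ ] ∃[ s₁ ] Dom p₁ × s₀ ≤ s₁ × Agree N s₀ p₀ p₁ ×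
                 (∀ x → Refuted (λ k′ → k′ ≢ k × k′ < s₁) N s₁ p₁ x)
      result with compactness em V (λ {m} {n} {x} → V-mono {m} {n} {x}) cover
      ... | m , h = p₁ , m ⊔ s₀ , d₁ , m≤n⊔m m s₀ ,
        Agree-trans (setColumn-agree N s₀ k p₀) (Agree-weaken (n≤1+n N) (n≤1+n s₀) a₁) ,
        λ x → V-mono {m} {m ⊔ s₀} {x} (m≤m⊔n m s₀) (h x)

    bounded : ∃[ M ] State (_< M)
    -- The limit 0 is arbitrary: this round serves to bound the answers by `s₁`.
    bounded with advance p s ≤-refl p-dom Agree-refl 0
    ... | p₁ , s₁ , d₁ , s≤s₁ , a₁ , h = s₁ , p₁ , s₁ , s≤s₁ , d₁ , a₁ ,
      λ x p′ a → map₂ (λ (k , (_ , k<s₁) , g) → k , k<s₁ , g) (h x p′ a)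

    -- The new point satisfies the old condition, so the old refutation persists; by
    -- `Says-functional` both refutations speak of the same answer.
    avoid : ∀ {R} k → State R → State (λ k′ → R k′ × k′ ≢ k)
    avoid {R} k (p₀ , s₀ , s≤s₀ , d₀ , a₀ , h) with advance p₀ s₀ s≤s₀ d₀ a₀ k
    ... | p₁ , s₁ , d₁ , s₀≤s₁ , a₁ , h′ =
      p₁ , s₁ , ≤-trans s≤s₀ s₀≤s₁ , d₁ , Agree-trans a₀ (Agree-weaken ≤-refl s≤s₀ a₁) , both
      where
      both : ∀ x → Refuted (λ k′ → R k′ × k′ ≢ k) N s₁ p₁ x
      both x p′ a
        with h x p′ (Agree-trans a₁ (Agree-weaken ≤-refl s₀≤s₁ a)) | h′ x p′ a
      ... | inj₁ g | _      = inj₁ g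
      ... | inj₂ _ | inj₁ g = inj₁ g
      ... | inj₂ (k₁ , r , g) | inj₂ (k₂ , (k₂≢k , _) , g′) with Says-functional N p′ x g g′
      ...   | refl = inj₂ (k₁ , (r , k₂≢k) , g)

    State-map : ∀ {R S : ℕ → Set} → (∀ {k} → R k → S k) → State R → State S
    State-map f (p₁ , s₁ , s≤s₁ , d₁ , a₁ , h) = p₁ , s₁ , s≤s₁ , d₁ , a₁ ,
      λ x p′ a → map₂ (λ (k , r , g) → k , f r , g) (h x p′ a)

    -- Each round removes the largest number still allowed as an answer.
    impossible : ∀ M → State (_< M) → State (λ _ → ⊥)
    impossible zero    = State-map λ ()
    impossible (suc M) = impossible M ∘ State-map (λ (l , k≢M) → ≤∧≢⇒< (s≤s⁻¹ l) k≢M) ∘ avoid M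

    ¬forced : ¬ Forced N s p
    ¬forced f with impossible _ (proj₂ bounded)
    ... | p₁ , s₁ , _ , d₁ , a₁ , h with f p₁ d₁ a₁
    ...   | x , ¬solved = [ ¬solved , (λ (_ , e , _) → e) ]′ (h x p₁ Agree-refl)

  abstract
    extend : ∀ {N s p} → Dom p → Forced N s p → Extension N s p
    extend d f = decidable-stable em λ ¬ext → Step.¬forced d ¬ext f

  -- The generic instance as limit of the conditions.

  record Condition (N : ℕ) : Set where
    field
      point  : Baire
      size   : ℕ
      N≤size : N ≤ size
      dom    : Dom point
      forced : Forced N size point

  open Condition

  next : ∀ {N} → Condition N → Condition (suc N)
  next c = let p′ , s′ , d , s<s′ , a , f = extend (dom c) (forced c) in record
    { point  = p′
    ; size   = s′
    ; N≤size = ≤-<-trans (N≤size c) s<s′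
    ; dom    = d
    ; forced = f
    }

  next-extends : ∀ {N} (c : Condition N) →
    size c ≤ size (next c) × Agree N (size c) (point c) (point (next c))
  next-extends c =
    let _ , _ , _ , s<s′ , a , _ = extend (dom c) (forced c) in <⇒≤ s<s′ , a

  module _ (out-avoidable : ∀ p → Dom p → ∃[ x ] ¬ Out p x) where

    condition : ∀ N → Condition N
    condition zero    = record
      { point  = λ _ → 0
      ; size   = 0
      ; N≤size = z≤n
      ; dom    = λ _ → 0 , 0 , λ _ _ → refl
      -- No column lies below 0, so avoiding `Out` suffices.
      ; forced = λ p′ d _ → let x , ¬o = out-avoidable p′ d in
                             x , [ ¬o , (λ { (_ , _ , () , _) }) ]′
      }
    condition (suc N) = next (condition N)

    condition-≤ : ∀ N j → size (condition N) ≤ size (condition (j + N)) ×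
      Agree N (size (condition N)) (point (condition N)) (point (condition (j + N)))
    condition-≤ N zero    = ≤-refl , Agree-refl
    condition-≤ N (suc j) =
      let l , a = condition-≤ N j ; l′ , a′ = next-extends (condition (j + N)) in
      ≤-trans l l′ , Agree-trans a (Agree-weaken (m≤n+m N j) l a′)

    -- Stage `suc i` has size above `i`, so entry `i` never changes afterwards.
    generic : Baire
    generic i = point (condition (suc i)) i

    generic-agree : ∀ N → Agree N (size (condition N)) (point (condition N)) generic
    -- Stages `N` and `suc i` are both compared with stage `suc i + N`.
    generic-agree N i d = trans (proj₂ (condition-≤ N (suc i)) i d)
      (trans (cong (λ M → point (condition M) i) (+-comm (suc i) N))
        (sym (proj₂ (condition-≤ (suc i) N) i (inj₁ (N≤size (condition (suc i)))))))

    generic-dom : Dom generic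
    generic-dom n with dom (condition (suc n)) n
    ... | l , h = l , Agree-⟶ ≤-refl (generic-agree (suc n)) h

    unsolved : ∀ N → ∃[ x ] ¬ Solved N generic x
    unsolved N = forced (condition N) generic generic-dom (generic-agree N)

    Solved-mono : ∀ {M N x} → M ≤ N → Solved M generic x → Solved N generic x
    Solved-mono M≤N = map₂ λ (n , k , n<M , h) → n , k , <-≤-trans n<M M≤N , h

    -- By compactness one `N` would serve all sequences, contrary to what stage `N` forces.
    generic-unsolved : ¬ (∀ x → ∃[ N ] Solved N generic x)
    generic-unsolved solved = let N , h = finite ; x , ¬h = unsolved N in ¬h (h x)
      where
      cover : ∀ x → ∃[ m ] ∀ x′ → x ≗[ m ] x′ → Solved m generic x′
      cover x with solved x
      ... | N , h with Solved-open h
      ...   | m , g = N ⊔ m , λ x′ b → Solved-mono (m≤m⊔n N m)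
                        (g generic x′ Agree-refl (≗[]-weaken (m≤n⊔m N m) b))

      finite : ∃[ N ] ∀ x → Solved N generic x
      finite = compactness em (λ N → Solved N generic) Solved-mono cover

-- The reduction

pair-≗[] : ∀ {p p′ q q′ m} → p ≗[ m ] p′ → q ≗[ m ] q′ → ⟨ p , q ⟩ ≗[ m ] ⟨ p′ , q′ ⟩
pair-≗[] a b i i<m with i % 2 ≡ᵇ 0
... | true  = a (i / 2) (≤-<-trans (m/n≤m i 2) i<m)
... | false = b (i / 2) (≤-<-trans (m/n≤m i 2) i<m)

pair-open : ∀ {U} → Open U → Open₂ (λ p x → U ⟨ p , toℕ ∘ x ⟩)
pair-open o p x u with o _ u
... | m , h = m , λ p′ x′ a b → h _ (pair-≗[] a λ i i<m → cong toℕ (b i i<m))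

applyUpTo-cong-< : ∀ {A : Set} {f g : ℕ → A} n → f ≗[ n ] g → applyUpTo f n ≡ applyUpTo g n
applyUpTo-cong-< zero    e = refl
applyUpTo-cong-< (suc n) e =
  cong₂ _∷_ (e 0 z<s) (applyUpTo-cong-< n λ i i<n → e (suc i) (s<s i<n))

-- If a name in the completion of the naturals denotes a number, that number is its first nonzero
-- entry minus one. `P` is a relation so as to cover machine outputs as well as sequences.
FirstAnswer : (ℕ → ℕ → Set) → ℕ → Set
FirstAnswer P k = ∃[ m ] P m (suc k) × (∀ j → j < m → P j 0)

FirstAnswer-map : ∀ (P Q : ℕ → ℕ → Set) {k} → (∀ {m y} → P m y → Q m y) →
                  FirstAnswer P k → FirstAnswer Q k
FirstAnswer-map P Q f (m , a , z) = m , f a , λ j j<m → f (z j j<m)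

FirstAnswer-functional : ∀ {P : ℕ → ℕ → Set} → (∀ {m y y′} → P m y → P m y′ → y ≡ y′) →
                         ∀ {k k′} → FirstAnswer P k → FirstAnswer P k′ → k ≡ k′
FirstAnswer-functional P-fun (m , a , z) (m′ , a′ , z′) with <-cmp m m′
... | tri≈ _ refl _ = suc-injective (P-fun a a′)
... | tri< m<m′ _ _ = contradiction (P-fun (z′ m m<m′) a) 0≢1+n
... | tri> _ _ m′<m = contradiction (P-fun (z m′ m′<m) a′) 0≢1+n

concat−1-head : ∀ c n {k ks} → concat−1 c n ≡ k ∷ ks → FirstAnswer (λ m y → c m ≡ y) k
concat−1-head c (suc n) e with c 0 in eq
... | suc _ = 0 , trans eq (cong suc (∷-injectiveˡ e)) , λ _ ()
... | zero with concat−1-head (c ∘ suc) n e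
...   | m , a , z = suc m , a , λ { zero _ → eq ; (suc j) (s<s j<m) → z j j<m }

−1≔-head : ∀ {c r} → c −1≔ r → FirstAnswer (λ m y → c m ≡ y) (r 0)
−1≔-head {c} {r} (h , l) with l 0
... | n , 0<len = go (concat−1 c n) refl (h n) 0<len
  where
  go : ∀ w → concat−1 c n ≡ w → w ≡ applyUpTo r (length w) → 0 < length w →
       FirstAnswer (λ m y → c m ≡ y) (r 0)
  go (k ∷ _) e e′ _ = concat−1-head c n (trans e e′)

Names : Baire → Tree → Set
Names q T = ∀ w → q (encode w) ≡ bit (χ T w)

Names-functional : ∀ {q S T} → Names q S → Names q T → χ S ≗ χ T
Names-functional h h′ w = bit-injective (trans (sym (h w)) (h′ w))

IsPathOf-resp : ∀ {S T x} → χ S ≗ χ T → x IsPathOf S → x IsPathOf T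
IsPathOf-resp e h n = trans (sym (e _)) (h n)

module _ (em : ExcludedMiddle 0ℓ) (H K : Baire⇀Baire)
         (H-computable : Computable H) (K-computable : Computable K)
         (reduces : ∀ G → G Realizes wkl → (H ∘ᵖ ⟨ idᵖ , G ∘ᵖ K ⟩ᵖ) Realizes stash nlim)
         where

  Preferred : Baire → Cantor → Baire → Tree → Set
  Preferred p x q T = graph K p q × x IsPathOf T

  -- The realizer of WKL that answers x to the tree K(p) if x is a path of it.
  -- It is undefined elsewhere than on names of infinite trees, so that a
  -- reduction cannot ask for anything else.
  preferring : Baire → Cantor → Baire⇀Baire
  preferring p x .graph q r = ∃[ T ] Names q T × Infinite T ×
    (Preferred p x q T × r ≗ toℕ ∘ x ⊎ ¬ Preferred p x q T × r ≗ toℕ ∘ leftmost em T)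
  preferring p x .graph-respˡ e (T , names , inf , ans) =
    T , (λ w → trans (sym (e _)) (names w)) , inf ,
    [ (λ ((Kpq , path) , h) → inj₁ ((graph-respʳ K e Kpq , path) , h))
    , (λ (¬pref , h) → inj₂ ((λ (Kpq , path) →
         ¬pref (graph-respʳ K (sym ∘ e) Kpq , path)) , h))
    ]′ ans
  preferring p x .graph-respʳ e (T , names , inf , ans) =
    T , names , inf ,
    [ (λ (pref , h) → inj₁ (pref , λ n → trans (sym (e n)) (h n)))
    , (λ (¬pref , h) → inj₂ (¬pref , λ n → trans (sym (e n)) (h n)))
    ]′ ans
  preferring p x .functional {q} (T , names , _ , ans) (T′ , names′ , _ , ans′) = go ans ans′
    where
    T≈T′ : χ T ≗ χ T′
    T≈T′ = Names-functional {q} {T} {T′} names names′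

    go : ∀ {r r′} →
      Preferred p x q T × r ≗ toℕ ∘ x ⊎ ¬ Preferred p x q T × r ≗ toℕ ∘ leftmost em T →
      Preferred p x q T′ × r′ ≗ toℕ ∘ x ⊎ ¬ Preferred p x q T′ × r′ ≗ toℕ ∘ leftmost em T′ →
      r ≗ r′
    go (inj₁ (_ , h)) (inj₁ (_ , h′)) n = trans (h n) (sym (h′ n))
    go (inj₂ (_ , h)) (inj₂ (_ , h′)) n =
      trans (h n) (trans (cong toℕ (leftmost-cong em {T} {T′} T≈T′ n)) (sym (h′ n)))
    go (inj₁ ((Kpq , path) , _)) (inj₂ (¬pref , _)) =
      ⊥-elim (¬pref (Kpq , IsPathOf-resp {T} {T′} T≈T′ path))
    go (inj₂ (¬pref , _)) (inj₁ ((Kpq , path) , _)) =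
      ⊥-elim (¬pref (Kpq , IsPathOf-resp {T′} {T} (sym ∘ T≈T′) path))

  preferring-realizes : ∀ p x → preferring p x Realizes wkl
  preferring-realizes p x q T names inf with em {Preferred p x q T}
  ... | yes pref = toℕ ∘ x , x , (T , names , inf , inj₁ (pref , λ _ → refl)) ,
                   (λ _ → refl) , proj₂ pref
  ... | no ¬pref = toℕ ∘ leftmost em T , leftmost em T ,
                   (T , names , inf , inj₂ (¬pref , λ _ → refl)) ,
                   (λ _ → refl) , leftmost-path em T inf

  -- The reduction is run with the realizer `preferring p x`: if `x` is a path of K(p), then `H`
  -- receives `p` paired with `x` and must be right in some column.
  response : ∀ p → Dom p → ∀ x →
    ∃[ q ] ∃[ T ] graph K p q × Names q T × Infinite T ×
    (x IsPathOf T → ∃[ s ] graph H ⟨ p , toℕ ∘ x ⟩ s ×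
      ∃[ n ] ∃[ k ] FirstAnswer (λ m y → column s n m ≡ y) k × ¬ (column p n ⟶ k))
  response p d x with reduces (preferring p x) (preferring-realizes p x)
                        p (column p) (λ _ _ → refl) d
  ... | s , y , (u , (p′ , r , p≗p′ , (q , Kpq , (T , names , inf , ans)) , e) , Hus) ,
        δsy , n , k , y≈k , ¬lim = q , T , Kpq , names , inf , λ path →
    s , graph-respˡ H (λ i → trans (sym (e i)) (⟨,⟩-cong (sym ∘ p≗p′) (r≗x path ans) i)) Hus ,
    n , k , head (y n) (δsy n) y≈k , ¬lim
    where
    r≗x : x IsPathOf T →
      Preferred p x q T × r ≗ toℕ ∘ x ⊎ ¬ Preferred p x q T × r ≗ toℕ ∘ leftmost em T →
      r ≗ toℕ ∘ x
    r≗x path (inj₁ (_ , h))     = h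
    r≗x path (inj₂ (¬pref , _)) = ⊥-elim (¬pref (Kpq , path))

    module ℕ̄ = RepresentedSpace (Completion ℕaturals)

    head : ∀ z → graph ℕ̄.δ (column s n) z → z ℕ̄.≈ just k →
           FirstAnswer (λ m y → column s n m ≡ y) k
    head (just _) (r , c , r0≡k) (just refl) =
      subst (FirstAnswer (λ m y → column s n m ≡ y)) r0≡k (−1≔-head c)

  -- The forcing relations read off the two machines.

  h : Code 1
  h = proj₁ H-computable

  κ : Code 1
  κ = proj₁ K-computable

  -- The machine for `K` rejects a prefix of `x`. Unlike the statement that `x` is no path of K(p),
  -- this makes sense for every `p` and is open.
  Out : Baire → Cantor → Set
  Out p x = ∃[ m ] ⟦ κ ⟧ p (encode (applyUpTo x m) ∷ []) 0

  Out-open : Open₂ Out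
  Out-open p x (m , o) with eval-open κ _ _ p o
  ... | m′ , g = m ⊔ m′ , λ p′ x′ a b → m ,
    subst (λ w → ⟦ κ ⟧ p′ (encode w ∷ []) 0)
      (applyUpTo-cong-< m (≗[]-weaken (m≤m⊔n m m′) b))
      (g p′ (≗[]-weaken (m≤n⊔m m m′) a))

  -- The machine is run even where `H` is undefined; a column may then get no answer, but never two.
  Says : ℕ → ℕ → Baire → Cantor → Set
  Says n k p x = FirstAnswer (λ m y → ⟦ h ⟧ ⟨ p , toℕ ∘ x ⟩ (⟨ n , m ⟩ₙ ∷ []) y) k

  Says-open : ∀ n k → Open₂ (Says n k)
  Says-open n k = pair-open
    {λ u → FirstAnswer (λ m y → ⟦ h ⟧ u (⟨ n , m ⟩ₙ ∷ []) y) k}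
    (open-∃ λ m → open-× (eval-open h _ _) (open-∀< (λ j → eval-open h _ _) m))

  Says-functional : ∀ n p x {k k′} → Says n k p x → Says n k′ p x → k ≡ k′
  Says-functional n p x = FirstAnswer-functional (eval-functional h)

  open Forcing em Out Says Out-open Says-open Says-functional

  ∈ᵗ⇒¬rejected : ∀ {p q T w} → graph K p q → Names q T → w ∈ᵗ T → ¬ ⟦ κ ⟧ p (encode w ∷ []) 0
  ∈ᵗ⇒¬rejected {w = w} Kpq names w∈T o = contradiction
    (trans (eval-functional κ o (proj₂ K-computable Kpq (encode w)))
           (trans (names w) (cong bit w∈T)))
    0≢1+n

  ¬Out⇒path : ∀ {p q T x} → graph K p q → Names q T → ¬ Out p x → x IsPathOf T
  ¬Out⇒path {p} {q} {T} {x} Kpq names ¬o n with χ T (applyUpTo x n) in eq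
  ... | true  = refl
  ... | false = ⊥-elim (¬o (n , subst (⟦ κ ⟧ p _) (trans (names _) (cong bit eq))
                                  (proj₂ K-computable Kpq _)))

  out-avoidable : ∀ p → Dom p → ∃[ x ] ¬ Out p x
  -- The zero sequence is a placeholder: only the infinite tree K(p) is wanted.
  out-avoidable p d with response p d (λ _ → 0F)
  ... | q , T , Kpq , names , inf , _ = leftmost em T , λ (m , o) →
    ∈ᵗ⇒¬rejected {p} {q} {T} Kpq names (leftmost-path em T inf m) o

  -- A sequence none of whose prefixes is rejected is a path of K(p), so the answer of `H` is right
  -- in some column, and the machine outputs that answer.
  solved-somewhere : ∀ p → Dom p → ∀ x → ∃[ N ] Solved N p x
  solved-somewhere p d x with em {Out p x}
  ... | yes o = 0 , inj₁ o
  ... | no ¬o with response p d x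
  ...   | q , T , Kpq , names , _ , answer with answer (¬Out⇒path {p} {q} {T} Kpq names ¬o)
  ...     | s , Hs , n , k , first , ¬lim =
    suc n , inj₂ (n , k , ≤-refl ,
      FirstAnswer-map (λ m y → column s n m ≡ y)
        (λ m y → ⟦ h ⟧ ⟨ p , toℕ ∘ x ⟩ (⟨ n , m ⟩ₙ ∷ []) y)
        (λ { refl → proj₂ H-computable Hs _ }) first , ¬lim)

  ¬reduces : ⊥
  ¬reduces = generic-unsolved out-avoidable
    (solved-somewhere (generic out-avoidable) (generic-dom out-avoidable))

proposition8p3 : (em : ExcludedMiddle 0ℓ) → ¬ (Stash NLIM ≤W WKL em)
proposition8p3 em (H , K , H-comp , K-comp , reduces) = ¬reduces em H K H-comp K-comp reduces
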